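{- Let $q$ be a positive integer. Then $$\sum_{n=1}^{\infty}\frac{1}{n!\;q^{\binom{n+q-1}{q}}}$$ is irrational.
   Context: $\binom{n+q-1}{q}$ is the ordinary binomial coefficient. -}

module Defs where

open import Data.Nat.Base as ℕ using (ℕ; zero; suc; _∸_; _^_; _!; NonZero)
open import Data.Nat.Combinatorics using (_C_)
open import Data.Nat.Properties using (_!≢0; m^n≢0; m*n≢0)
open import Data.Integer.Base using (1ℤ)
open import Data.Product.Base using (_,_; _×_; ∃-syntax)
open import Data.Rational.Base
  using (ℚ; 0ℚ; _/_; _+_; _-_; ∣_∣; _<_)
open import Data.Rational.Properties using (+-inverseʳ)
open import Relation.Binary.PropositionalEquality using (sym; subst; cong)
open import Relation.Nullary.Negation.Core using (¬_)

infix 4 _≃_ _ConvergesTo_ _IsSumOfSeries_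

Eventually : (ℕ → Set) → Set
Eventually P = ∃[ N ] (∀ n → N ℕ.≤ n → P n)

IsCauchy : (ℕ → ℚ) → Set
IsCauchy s = ∀ ε → 0ℚ < ε →
  ∃[ N ] (∀ m n → N ℕ.≤ m → N ℕ.≤ n → ∣ s m - s n ∣ < ε)

-- Real numbers as Cauchy sequences of rationals; the equality is _≃_ below.
record ℝ : Set where
  constructor mkℝ
  field
    seq    : ℕ → ℚ
    cauchy : IsCauchy seq

open ℝ public

-- For Cauchy sequences this lies between ∣ x - y ∣ < ε and ∣ x - y ∣ ≤ ε,
-- so it may replace either of them under a quantifier over all ε > 0.
Within : ℚ → ℝ → ℝ → Set
Within ε x y = Eventually λ k → ∣ seq x k - seq y k ∣ < ε

_≃_ : ℝ → ℝ → Set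
x ≃ y = ∀ ε → 0ℚ < ε → Within ε x y

fromℚ : ℚ → ℝ
fromℚ p = mkℝ (λ _ → p) λ ε 0<ε →
  0 , λ _ _ _ _ → subst (_< ε) (sym (cong ∣_∣ (+-inverseʳ p))) 0<ε

Irrational : ℝ → Set
Irrational x = ¬ (∃[ p ] x ≃ fromℚ p)

_ConvergesTo_ : (ℕ → ℝ) → ℝ → Set
s ConvergesTo x = ∀ ε → 0ℚ < ε → Eventually λ n → Within ε (s n) x

-- a 1 + a 2 + ⋯ + a N; the value a 0 is not used.
partialSum : (ℕ → ℚ) → ℕ → ℚ
partialSum a zero    = 0ℚ
partialSum a (suc N) = partialSum a N + a (suc N)

-- x = ∑_{n = 1}^∞ a n
_IsSumOfSeries_ : ℝ → (ℕ → ℚ) → Set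
x IsSumOfSeries a = (λ N → fromℚ (partialSum a N)) ConvergesTo x

denominator : ℕ → ℕ → ℕ
denominator q n = n ! ℕ.* q ^ ((n ℕ.+ q ∸ 1) C q)

denominator≢0 : ∀ q .{{_ : NonZero q}} n → NonZero (denominator q n)
denominator≢0 q n =
  m*n≢0 (n !) _ {{n !≢0}} {{m^n≢0 q ((n ℕ.+ q ∸ 1) C q)}}

term : (q : ℕ) .{{_ : NonZero q}} → ℕ → ℚ
term q n = _/_ 1ℤ (denominator q n) {{denominator≢0 q n}}

{-# OPTIONS --safe #-}
module Submission where

-- Write the series as ∑ 1 / D n with (n + 1) D n ∣ D (n + 1). The partial sum
-- S n is an integer over D n. From n = 2 on, D (n + 1) > 2 D n, so S n + 1 / D n
-- strictly decreases and the sum lies strictly between S n and S n + 1 / D n.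
-- A rational with denominator d is also an integer over D n once n ≥ d, since
-- d ∣ D d ∣ D n, so it cannot lie strictly between these neighbouring fractions.

open import Data.Nat.Base as ℕ using (ℕ; zero; suc; NonZero; z≤n; s≤s; _!; _^_)
open import Data.Nat.Combinatorics using (_C_; nCk+nC[k+1]≡[n+1]C[k+1])
open import Data.Nat.Divisibility
  using (_∣_; divides; ∣-trans; m∣m*n; n∣m*n; ∣⇒≤; *-monoʳ-∣)
import Data.Nat.Properties as ℕ
open import Data.Integer.Base as ℤ using (+_; 1ℤ; +<+)
import Data.Integer.Properties as ℤ
import Data.Integer.Solver as ℤ
open import Data.Product.Base using (_×_; _,_; ∃-syntax)
open import Data.Rational.Base
  using (ℚ; 0ℚ; _/_; _+_; _-_; -_; ∣_∣; _≤_; _<_; _≥_; ↥_; ↧_; ↧ₙ_; positive; toℚᵘ)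
open import Data.Rational.Properties
import Data.Rational.Unnormalised.Base as ℚᵘ
import Data.Rational.Unnormalised.Properties as ℚᵘ
open import Data.Sum.Base using (inj₁; inj₂)
open import Function.Base using (_∘_)
open import Relation.Binary.Core using (Rel)
open import Relation.Binary.Definitions using (Reflexive; Transitive)
open import Relation.Binary.PropositionalEquality
  using (_≡_; refl; sym; trans; cong; subst; subst₂)
open import Relation.Nullary.Negation.Core using (¬_)
open import Algebra.Properties.AbelianGroup +-0-abelianGroup using (xyx⁻¹≈y; ⁻¹-anti-homo‿-)
open import Defs

-- `/` cancels common factors, which hides the given numerator and denominator. Passing to
-- unnormalised fractions lets the lemmas below argue by cross-multiplication.
toℚᵘ-/ : ∀ i n .{{_ : NonZero n}} → toℚᵘ (i / n) ℚᵘ.≃ i ℚᵘ./ n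
toℚᵘ-/ i (suc n) = toℚᵘ-fromℚᵘ (ℚᵘ.mkℚᵘ i n)

/-mono-< : ∀ i j m n .{{_ : NonZero m}} .{{_ : NonZero n}} →
           i ℤ.* + n ℤ.< j ℤ.* + m → i / m < j / n
/-mono-< i j m@(suc _) n@(suc _) in<jm = toℚᵘ-cancel-<
  (ℚᵘ.<-respˡ-≃ (ℚᵘ.≃-sym (toℚᵘ-/ i m))
    (ℚᵘ.<-respʳ-≃ (ℚᵘ.≃-sym (toℚᵘ-/ j n)) (ℚᵘ.*<* in<jm)))

/-cancel-< : ∀ i j n .{{_ : NonZero n}} → i / n < j / n → i ℤ.< j
/-cancel-< i j n@(suc _) i/n<j/n
  with ℚᵘ.*<* in<jn ← ℚᵘ.<-respˡ-≃ (toℚᵘ-/ i n) (ℚᵘ.<-respʳ-≃ (toℚᵘ-/ j n) (toℚᵘ-mono-< i/n<j/n))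
  = ℤ.*-cancelʳ-<-nonNeg (+ n) in<jn

/-distribʳ-+ : ∀ i j n .{{_ : NonZero n}} → (i ℤ.+ j) / n ≡ i / n + j / n
/-distribʳ-+ i j n@(suc _) = toℚᵘ-injective (begin
  toℚᵘ ((i ℤ.+ j) / n)            ≈⟨ toℚᵘ-/ (i ℤ.+ j) n ⟩
  (i ℤ.+ j) ℚᵘ./ n                ≈⟨ ℚᵘ.*≡* (solve 3 (λ i j n →
    (i :+ j) :* (n :* n) := (i :* n :+ j :* n) :* n) refl i j (+ n)) ⟩
  i ℚᵘ./ n ℚᵘ.+ j ℚᵘ./ n          ≈⟨ ℚᵘ.+-cong (toℚᵘ-/ i n) (toℚᵘ-/ j n) ⟨
  toℚᵘ (i / n) ℚᵘ.+ toℚᵘ (j / n)  ≈⟨ toℚᵘ-homo-+ (i / n) (j / n) ⟨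
  toℚᵘ (i / n + j / n)            ∎)
  where
  open ℤ.+-*-Solver
  open import Relation.Binary.Reasoning.Setoid ℚᵘ.≃-setoid

/-expand : ∀ {m n} .{{_ : NonZero m}} .{{_ : NonZero n}} →
           m ∣ n → ∀ i → ∃[ j ] i / m ≡ j / n
/-expand {m@(suc _)} {n@(suc _)} (divides k n≡k*m) i = i ℤ.* + k , toℚᵘ-injective (begin
  toℚᵘ (i / m)              ≈⟨ toℚᵘ-/ i m ⟩
  i ℚᵘ./ m                  ≈⟨ ℚᵘ.*≡* (trans (cong (i ℤ.*_) (trans (cong +_ n≡k*m) (ℤ.pos-* k m)))
                                             (sym (ℤ.*-assoc i (+ k) (+ m)))) ⟩
  (i ℤ.* + k) ℚᵘ./ n        ≈⟨ toℚᵘ-/ (i ℤ.* + k) n ⟨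
  toℚᵘ ((i ℤ.* + k) / n)    ∎)
  where open import Relation.Binary.Reasoning.Setoid ℚᵘ.≃-setoid

-- Clearing `n` would put the integer `j` strictly between `i` and `i + 1`.
¬between-neighbours : ∀ i j n .{{_ : NonZero n}} → i / n < j / n → ¬ j / n < i / n + 1ℤ / n
¬between-neighbours i j n i<j j<i+1 = ℤ.≤⇒≯ (ℤ.i<j⇒suc[i]≤j (/-cancel-< i j n i<j))
  (subst (j ℤ.<_) (ℤ.+-comm i 1ℤ)
    (/-cancel-< j (i ℤ.+ 1ℤ) n (subst (j / n <_) (sym (/-distribʳ-+ i 1ℤ n)) j<i+1)))

1/n<ε : ∀ ε → 0ℚ < ε → ∀ n .{{_ : NonZero n}} → ↧ₙ ε ℕ.< n → 1ℤ / n < ε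
1/n<ε ε@record{} 0<ε n d<n = subst (1ℤ / n <_) (↥p/↧p≡p ε) (/-mono-< 1ℤ (↥ ε) n (↧ₙ ε) (begin-strict
  1ℤ ℤ.* ↧ ε   ≡⟨ ℤ.*-identityˡ (↧ ε) ⟩
  ↧ ε          <⟨ +<+ d<n ⟩
  + n          ≡⟨ ℤ.*-identityˡ (+ n) ⟨
  -- The numerator of a positive rational is at least 1.
  1ℤ ℤ.* + n   ≤⟨ ℤ.*-monoʳ-≤-nonNeg (+ n) (ℤ.i<j⇒suc[i]≤j (ℤ.positive⁻¹ (↥ ε) {{positive 0<ε}})) ⟩
  ↥ ε ℤ.* + n  ∎))
  where open ℤ.≤-Reasoning

∣p∣≤ : ∀ {p b} → p ≤ b → - p ≤ b → ∣ p ∣ ≤ b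
∣p∣≤ {p} p≤b -p≤b with ∣p∣≡p∨∣p∣≡-p p
... | inj₁ eq = subst (_≤ _) (sym eq) p≤b
... | inj₂ eq = subst (_≤ _) (sym eq) -p≤b

p≤∣p∣ : ∀ p → p ≤ ∣ p ∣
p≤∣p∣ p with ≤-total 0ℚ p
... | inj₁ 0≤p = ≤-reflexive (sym (0≤p⇒∣p∣≡p 0≤p))
... | inj₂ p≤0 = ≤-trans p≤0 (0≤∣p∣ p)

∣p-q∣≡∣q-p∣ : ∀ p q → ∣ p - q ∣ ≡ ∣ q - p ∣
∣p-q∣≡∣q-p∣ p q = trans (sym (∣-p∣≡∣p∣ (p - q))) (cong ∣_∣ (⁻¹-anti-homo‿- p q))

∣x-y∣≤u-l : ∀ {l u x y} → l ≤ x → x ≤ u → l ≤ y → y ≤ u → ∣ x - y ∣ ≤ u - l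
∣x-y∣≤u-l {x = x} {y} l≤x x≤u l≤y y≤u = ∣p∣≤
  (+-mono-≤ x≤u (neg-antimono-≤ l≤y))
  (subst (_≤ _) (sym (⁻¹-anti-homo‿- x y)) (+-mono-≤ y≤u (neg-antimono-≤ l≤x)))

p<q⇒0<q-p : ∀ {p q} → p < q → 0ℚ < q - p
p<q⇒0<q-p {p} {q} p<q = subst (_< q - p) (+-inverseʳ p) (+-monoˡ-< (- p) p<q)

module _ {x : ℝ} {p : ℚ} (x≃p : x ≃ fromℚ p) where

  -- If `p < l`, then far enough out `seq x k` is at least `l` and yet at distance less than `l - p`
  -- from `p`, which is absurd.
  ≤-limit : ∀ {l} n → (∀ k → n ℕ.≤ k → l ≤ seq x k) → l ≤ p
  ≤-limit {l} n l≤x = ≮⇒≥ λ p<l →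
    let N , close = x≃p (l - p) (p<q⇒0<q-p p<l)
        k = n ℕ.⊔ N
    in <-irrefl refl (≤-<-trans
         (≤-trans (+-monoˡ-≤ (- p) (l≤x k (ℕ.m≤m⊔n n N))) (p≤∣p∣ (seq x k - p)))
         (close k (ℕ.m≤n⊔m n N)))

  limit-≤ : ∀ {u} n → (∀ k → n ℕ.≤ k → seq x k ≤ u) → p ≤ u
  limit-≤ {u} n x≤u = ≮⇒≥ λ u<p →
    let N , close = x≃p (p - u) (p<q⇒0<q-p u<p)
        k = n ℕ.⊔ N
    in <-irrefl refl (≤-<-trans
         (≤-trans (+-monoʳ-≤ p (neg-antimono-≤ (x≤u k (ℕ.m≤m⊔n n N)))) (p≤∣p∣ (p - seq x k)))
         (subst (_< p - u) (∣p-q∣≡∣q-p∣ (seq x k) p) (close k (ℕ.m≤n⊔m n N))))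

-- An arbitrary relation is allowed so that one induction serves both the increasing `S` and the
-- decreasing `U`.
steps⇒mono : ∀ {a ℓ} {A : Set a} {_∼_ : Rel A ℓ} → Reflexive _∼_ → Transitive _∼_ →
             ∀ (f : ℕ → A) {m n} → (∀ k → m ℕ.≤ k → f k ∼ f (suc k)) → m ℕ.≤ n → f m ∼ f n
steps⇒mono {_∼_ = _∼_} ∼-refl ∼-trans f {m} step = go ∘ ℕ.≤⇒≤′
  where
  go : ∀ {n} → m ℕ.≤′ n → f m ∼ f n
  go (ℕ.≤′-reflexive refl) = ∼-refl
  go (ℕ.≤′-step m≤′n)      = ∼-trans (go m≤′n) (step _ (ℕ.≤′⇒≤ m≤′n))

module ReciprocalSeries (D : ℕ → ℕ) {{D≢0 : ∀ {n} → NonZero (D n)}}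
    (D-step : ∀ n → suc n ℕ.* D n ∣ D (suc n)) where

  private
    a S U : ℕ → ℚ
    a n = 1ℤ / D n
    S = partialSum a
    U n = S n + a n

  D∣D-suc : ∀ n → D n ∣ D (suc n)
  D∣D-suc n = ∣-trans (n∣m*n (suc n)) (D-step n)

  n∣D : ∀ n .{{_ : NonZero n}} → n ∣ D n
  n∣D (suc n) = ∣-trans (m∣m*n (D n)) (D-step n)

  S-fraction : ∀ n → ∃[ i ] S n ≡ i / D n
  S-fraction zero    = + 0 , sym (0/n≡0 (D 0))
  S-fraction (suc n) =
    let i , S≡i = S-fraction n
        j , i≡j = /-expand (D∣D-suc n) i
    -- Over the new denominator, the new term adds 1 to the numerator.
    in j ℤ.+ 1ℤ , trans (cong (_+ a (suc n)) (trans S≡i i≡j)) (sym (/-distribʳ-+ j 1ℤ (D (suc n))))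

  0<a : ∀ n → 0ℚ < a n
  0<a n = positive⁻¹ (a n) {{normalize-pos 1 (D n)}}

  p<p+a : ∀ p n → p < p + a n
  p<p+a p n = subst (_< p + a n) (+-identityʳ p) (+-monoʳ-< p (0<a n))

  S-mono-≤ : ∀ {m n} → m ℕ.≤ n → S m ≤ S n
  S-mono-≤ = steps⇒mono {_∼_ = _≤_} ≤-refl ≤-trans S λ k _ → <⇒≤ (p<p+a (S k) (suc k))

  -- `D-step` yields a factor of at least `suc n`, which exceeds 2 only from `n = 2` on.
  2D<D-suc : ∀ n → 2 ℕ.≤ n → 2 ℕ.* D n ℕ.< D (suc n)
  2D<D-suc n 2≤n = ℕ.<-≤-trans (ℕ.*-monoˡ-< (D n) (s≤s 2≤n)) (∣⇒≤ (D-step n))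

  U-step : ∀ n → 2 ℕ.≤ n → U (suc n) < U n
  U-step n 2≤n = begin-strict
    S n + a (suc n) + a (suc n)    ≡⟨ +-assoc (S n) (a (suc n)) (a (suc n)) ⟩
    S n + (a (suc n) + a (suc n))  ≡⟨ cong (_+_ (S n)) (/-distribʳ-+ 1ℤ 1ℤ (D (suc n))) ⟨
    S n + + 2 / D (suc n)          <⟨ +-monoʳ-< (S n) (/-mono-< (+ 2) 1ℤ (D (suc n)) (D n) 2D<D) ⟩
    S n + a n                      ∎
    where
    open ≤-Reasoning
    2D<D : + 2 ℤ.* + D n ℤ.< 1ℤ ℤ.* + D (suc n)
    2D<D = subst₂ ℤ._<_ (ℤ.pos-* 2 (D n)) (sym (ℤ.*-identityˡ _)) (+<+ (2D<D-suc n 2≤n))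

  -- `S n` is below `U n`, and `U` decreases from `m` to `n`.
  S≤U : ∀ {m n} → 2 ℕ.≤ m → m ℕ.≤ n → S n ≤ U m
  S≤U {m} {n} 2≤m m≤n = ≤-trans (<⇒≤ (p<p+a (S n) n))
    (steps⇒mono {_∼_ = _≥_} ≤-refl (λ x≥y y≥z → ≤-trans y≥z x≥y) U
      (λ k m≤k → <⇒≤ (U-step k (ℕ.≤-trans 2≤m m≤k))) m≤n)

  -- From `N` on, all partial sums lie between `S N` and `U N`, an interval of length `a N`.
  S-cauchy : IsCauchy S
  S-cauchy ε 0<ε = N , λ m n N≤m N≤n → ≤-<-trans
    (∣x-y∣≤u-l (S-mono-≤ N≤m) (S≤U 2≤N N≤m) (S-mono-≤ N≤n) (S≤U 2≤N N≤n))
    (subst (_< ε) (sym (xyx⁻¹≈y (S N) (a N))) (1/n<ε ε 0<ε (D N) (∣⇒≤ (n∣D N))))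
    where
    -- `N` divides `D N`, so `D N` exceeds the denominator of `ε` and `a N < ε`.
    N = suc (↧ₙ ε)
    2≤N : 2 ℕ.≤ N
    2≤N = s≤s (s≤s z≤n)

  sum : ℝ
  sum = mkℝ S S-cauchy

  sum-isSumOfSeries : sum IsSumOfSeries a
  sum-isSumOfSeries ε 0<ε =
    let N , close = S-cauchy ε 0<ε
    in N , λ n N≤n → N , λ k N≤k → close n k N≤n N≤k

  sum-irrational : Irrational sum
  sum-irrational (p , sum≃p) =
    let i , S≡i = S-fraction n
        j , p≡j = /-expand (∣-trans (n∣D d) (D∣D-suc d)) (↥ p)
        p≡j/D   = trans (sym (↥p/↧p≡p p)) p≡j
    in ¬between-neighbours i j (D n)
         (subst₂ _<_ S≡i p≡j/D S<p)
         (subst₂ _<_ p≡j/D (cong (_+ a n) S≡i) p<U)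
    where
    d = ↧ₙ p
    -- The successor guarantees `2 ≤ n` even when `p` is an integer; `d` divides `D d` and hence
    -- `D n`.
    n = suc d
    2≤n : 2 ℕ.≤ n
    2≤n = s≤s (s≤s z≤n)
    S<p : S n < p
    -- Limits preserve only weak inequalities. Both bounds are therefore taken at `suc n`, and the
    -- strict step from `n` to `suc n` supplies the strictness.
    S<p = <-≤-trans (p<p+a (S n) (suc n)) (≤-limit {sum} sum≃p (suc n) λ _ → S-mono-≤)
    p<U : p < U n
    p<U = ≤-<-trans (limit-≤ {sum} sum≃p (suc n) λ _ → S≤U (ℕ.m≤n⇒m≤1+n 2≤n)) (U-step n 2≤n)

-- By Pascal's rule, the right side is the left side plus another binomial coefficient.
nCk≤[1+n]Ck : ∀ n k → n C k ℕ.≤ suc n C k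
nCk≤[1+n]Ck n zero    = ℕ.≤-refl
nCk≤[1+n]Ck n (suc k) =
  subst (n C suc k ℕ.≤_) (nCk+nC[k+1]≡[n+1]C[k+1] n k) (ℕ.m≤n+m (n C suc k) (n C k))

[n∸1]Ck≤nCk : ∀ n k → (n ℕ.∸ 1) C k ℕ.≤ n C k
[n∸1]Ck≤nCk zero    k = ℕ.≤-refl
[n∸1]Ck≤nCk (suc n) k = nCk≤[1+n]Ck n k

^-monoʳ-∣ : ∀ b {m n} → m ℕ.≤ n → b ^ m ∣ b ^ n
^-monoʳ-∣ b {m} {n} m≤n =
  subst (b ^ m ∣_) (trans (sym (ℕ.^-distribˡ-+-* b m _)) (cong (b ^_) (ℕ.m+[n∸m]≡n m≤n))) (m∣m*n _)

-- The factor `suc n` completes the factorial, and the exponent of `q` does not decrease.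
denominator-step : ∀ q n → suc n ℕ.* denominator q n ∣ denominator q (suc n)
denominator-step q n =
  subst (_∣ denominator q (suc n)) (ℕ.*-assoc (suc n) (n !) _)
    (*-monoʳ-∣ (suc n !) (^-monoʳ-∣ q ([n∸1]Ck≤nCk (n ℕ.+ q) q)))

corollary62 : (q : ℕ) .{{_ : NonZero q}} →
    ∃[ x ] (x IsSumOfSeries (term q) × Irrational x)
corollary62 q = sum , sum-isSumOfSeries , sum-irrational
  where
  open ReciprocalSeries (denominator q) {{λ {n} → denominator≢0 q n}} (denominator-step q)
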